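{- Let $H$ be a graph of order $h$ with $\eta(H)=a$. Then $H$ has arbitrarily large induced extensions $G$ (that is, arbitrarily large graphs $G$ containing $H$ as an induced subgraph) such that $$\eta(G)=a,\qquad \eta_\ell(G)\ge\eta_\ell(H),\qquad\text{and}\qquad \delta(G)=n-\sqrt{\frac{2n}{2a-1}}+O_H(1),$$ where $n=|V(G)|$. Moreover, the displayed minimum-degree estimate is asymptotically best possible among graphs with additive number $a$.
   Context: All graphs are finite and simple; $\delta(G)$ is the minimum degree of $G$, and the order of $G$ is $|V(G)|$. $\mathbb N$ denotes the positive integers and $[k]=\{1,2,\ldots,k\}$. For a graph $G$ and a labeling $\ell:V(G)\to\mathbb N$, put $S_\ell(v)=\sum_{w\in N(v)}\ell(w)$, where $N(v)$ is the open neighborhood of $v$. The labeling $\ell$ is an additive labeling if $S_\ell(u)\ne S_\ell(v)$ for every edge $uv\in E(G)$. The additive number $\eta(G)$ is the least $k$ such that $G$ has an additive labeling with labels in $[k]$. The list additive number $\eta_\ell(G)$ is the least $k$ such that every assignment of $k$-element lists $L(v)\subset\mathbb N$ to the vertices $v\in V(G)$ admits an additive labeling $\ell$ of $G$ with $\ell(v)\in L(v)$ for every vertex $v$. (The subscript in $\eta_\ell(G)$ is only notation and does not refer to a particular labeling.) $O_H(1)$ denotes a quantity bounded in absolute value by a constant depending only on $H$. -}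

module Defs where

open import Data.Bool.Base using (Bool; true; false)
open import Data.Fin.Base using (Fin)
open import Data.List.Base using (List; length; map; sum; filterᵇ; allFin)
open import Data.List.Membership.Propositional using (_∈_)
open import Data.List.Relation.Unary.All using (All)
open import Data.List.Relation.Unary.Unique.Propositional using (Unique)
open import Data.Nat.Base using (ℕ; _+_; _*_; _∸_; _^_; _≤_)
open import Data.Product.Base using (_×_; ∃-syntax)
open import Function.Definitions using (Injective)
open import Relation.Binary.PropositionalEquality using (_≡_; _≢_)

record Graph (n : ℕ) : Set where
  field
    adj       : Fin n → Fin n → Bool
    symmetric : ∀ u v → adj u v ≡ adj v u
    loopless  : ∀ v → adj v v ≡ false

  Edge : Fin n → Fin n → Set
  Edge u v = adj u v ≡ true

  neighbours : Fin n → List (Fin n)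
  neighbours v = filterᵇ (adj v) (allFin n)

  degree : Fin n → ℕ
  degree v = length (neighbours v)

open Graph public

IsMinDegree : ∀ {n} → Graph n → ℕ → Set
IsMinDegree G δ = (∃[ v ] degree G v ≡ δ) × (∀ v → δ ≤ degree G v)

-- H is, up to isomorphism, an induced subgraph of G.
IsInducedSubgraph : ∀ {h n} → Graph h → Graph n → Set
IsInducedSubgraph {h} {n} H G =
  ∃[ f ] Injective {A = Fin h} {B = Fin n} _≡_ _≡_ f
       × (∀ u v → adj G (f u) (f v) ≡ adj H u v)

neighbourSum : ∀ {n} → Graph n → (Fin n → ℕ) → Fin n → ℕ
neighbourSum G ℓ v = sum (map ℓ (neighbours G v))

-- Labels are positive integers, whereas ℕ here contains 0.
IsAdditiveLabelling : ∀ {n} → Graph n → (Fin n → ℕ) → Set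
IsAdditiveLabelling G ℓ =
    (∀ v → 1 ≤ ℓ v)
  × (∀ u v → Edge G u v → neighbourSum G ℓ u ≢ neighbourSum G ℓ v)

HasAdditiveLabelling : ∀ {n} → Graph n → ℕ → Set
HasAdditiveLabelling G k =
  ∃[ ℓ ] IsAdditiveLabelling G ℓ × (∀ v → ℓ v ≤ k)

-- A k-element set of positive integers, listed without repetition.
IsLabelList : ℕ → List ℕ → Set
IsLabelList k xs = Unique xs × length xs ≡ k × All (1 ≤_) xs

HasListAdditiveLabellings : ∀ {n} → Graph n → ℕ → Set
HasListAdditiveLabellings {n} G k =
  (L : Fin n → List ℕ) → (∀ v → IsLabelList k (L v)) →
  ∃[ ℓ ] IsAdditiveLabelling G ℓ × (∀ v → ℓ v ∈ L v)

IsLeastPositive : (ℕ → Set) → ℕ → Set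
IsLeastPositive P k = 1 ≤ k × P k × (∀ j → 1 ≤ j → P j → k ≤ j)

-- η(G) = k
IsAdditiveNumber : ∀ {n} → Graph n → ℕ → Set
IsAdditiveNumber G = IsLeastPositive (HasAdditiveLabelling G)

-- η_ℓ(G) = k.  Such a k always exists classically: choosing labels vertex by
-- vertex, every edge uv excludes at most one value, at the last vertex whose
-- label has a nonzero coefficient in S(u) − S(v); so |E(G)| + 1 labels per list
-- suffice.
IsListAdditiveNumber : ∀ {n} → Graph n → ℕ → Set
IsListAdditiveNumber G = IsLeastPositive (HasListAdditiveLabellings G)

-- The real number √(p/q), for q > 0, enters only through its comparisons with
-- natural numbers y, which are decided by squaring.
√[_/_]≤_ : ℕ → ℕ → ℕ → Set
√[ p / q ]≤ y = p ≤ q * y ^ 2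

_≤√[_/_] : ℕ → ℕ → ℕ → Set
y ≤√[ p / q ] = q * y ^ 2 ≤ p

-- δ ≤ n − √(2n/(2a−1)) + C, for δ ≤ n and a ≥ 1
UpperEstimate : (a C n δ : ℕ) → Set
UpperEstimate a C n δ = √[ 2 * n / 2 * a ∸ 1 ]≤ ((n ∸ δ) + C)

-- δ ≥ n − √(2n/(2a−1)) − C, for δ ≤ n and a ≥ 1.  The truncation in
-- (n ∸ δ) ∸ C is harmless because a square root is nonnegative.
LowerEstimate : (a C n δ : ℕ) → Set
LowerEstimate a C n δ = ((n ∸ δ) ∸ C) ≤√[ 2 * n / 2 * a ∸ 1 ]

{-# OPTIONS --safe #-}

-- Let D(v) be the sum of the labels of the vertices not adjacent to v, the
-- vertex v included.  Since S(v) + D(v) is the sum of all labels, a labelling is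
-- additive iff D separates adjacent vertices.  Put d = n − δ.
--
-- For an additive labelling with labels in [a], the vertices with D = t form an
-- independent set, so there are at most min(t, d) of them, and D ≤ a d.  Hence
-- n ≤ ∑_{t ≤ ad} min(t, d) = ((2a − 1) d² + d) / 2.
--
-- In a join, D is computed inside each factor.  So a labelling of a join H ∨ M
-- restricts to H, and H ∨ M is additively labelled as soon as both factors are
-- and D takes larger values on M than on H.  As D ≤ a h on H, we let M be the
-- complete multipartite graph with one part of size min(t, d) and label sum t
-- for each t with a h < t ≤ a d.

module Submission where

import Algebra.Properties.Semiring.Sum
open import Data.Bool.Base using (Bool; true; false; T; if_then_else_)
open import Data.Fin.Base using (Fin; zero; suc; splitAt; _↑ˡ_; _↑ʳ_)
open import Data.Fin.Properties
  using (any?; splitAt-↑ˡ; splitAt-↑ʳ; ↑ˡ-injective; join-splitAt)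
open import Data.List.Base using (List; []; _∷_; length; map; filterᵇ; tabulate; applyUpTo)
open import Data.List.Membership.Propositional using (_∈_)
open import Data.List.Properties using (length-applyUpTo)
import Data.List.Relation.Unary.All.Properties as All
import Data.List.Relation.Unary.Unique.Propositional.Properties as Unique
open import Data.Nat.Base
  using (ℕ; zero; suc; _+_; _*_; _∸_; _^_; _⊓_; _≤_; _<_; z≤n; s≤s; s<s; _<ᵇ_; _≡ᵇ_)
import Data.Nat.ListAction as List
open import Data.Nat.Properties
open import Data.Nat.Tactic.RingSolver using (solve-∀)
open import Data.Product.Base using (_×_; _,_; proj₁; proj₂; ∃-syntax; Σ-syntax)
open import Data.Sum.Base using (_⊎_; inj₁; inj₂)
open import Data.Vec.Functional using (_++_)
open import Data.Vec.Functional.Properties using (lookup-++ˡ; lookup-++ʳ)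
open import Function.Base using (_∘_; id; const)
open import Relation.Binary.PropositionalEquality
  using (_≡_; _≢_; refl; sym; trans; cong; cong₂; subst; subst₂; module ≡-Reasoning)
open import Relation.Nullary.Decidable using (yes; no; dec-false)
open import Defs

module ∑ = Algebra.Properties.Semiring.Sum +-*-semiring
open ∑ using (sum; sum-syntax; sum-cong-≗; ∑-distrib-+)

-- Finite sums

sum-mono-≤ : ∀ {n} {f g : Fin n → ℕ} → (∀ i → f i ≤ g i) → sum f ≤ sum g
sum-mono-≤ {zero}  f≤g = z≤n
sum-mono-≤ {suc n} f≤g = +-mono-≤ (f≤g zero) (sum-mono-≤ (f≤g ∘ suc))

sum-const : ∀ n c → ∑[ _ < n ] c ≡ n * c
sum-const zero    c = refl
sum-const (suc n) c = cong (c +_) (sum-const n c)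

sum-one : ∀ n → ∑[ _ < n ] 1 ≡ n
sum-one n = trans (sum-const n 1) (*-identityʳ n)

sum-↑ : ∀ m {n} (f : Fin (m + n) → ℕ) →
        sum f ≡ sum (f ∘ (_↑ˡ n)) + sum (f ∘ (m ↑ʳ_))
sum-↑ zero    f = refl
sum-↑ (suc m) f = trans (cong (f zero +_) (sum-↑ m (f ∘ suc)))
                        (sym (+-assoc (f zero) _ _))

-- The arbitrary `g` makes the induction go through, since the tail of `allFin` is no `allFin`; the
-- case used is `g = id`.
sum-filterᵇ-tabulate : ∀ {A : Set} {n} (p : A → Bool) (ℓ : A → ℕ) (g : Fin n → A) →
  List.sum (map ℓ (filterᵇ p (tabulate g))) ≡ ∑[ i < n ] (if p (g i) then ℓ (g i) else 0)
sum-filterᵇ-tabulate {n = zero}  p ℓ g = refl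
sum-filterᵇ-tabulate {n = suc n} p ℓ g with p (g zero)
... | true  = cong (ℓ (g zero) +_) (sum-filterᵇ-tabulate p ℓ (g ∘ suc))
... | false = sum-filterᵇ-tabulate p ℓ (g ∘ suc)

length≡sum-map-1 : ∀ {A : Set} (xs : List A) → length xs ≡ List.sum (map (const 1) xs)
length≡sum-map-1 [] = refl
length≡sum-map-1 (x ∷ xs) = cong suc (length≡sum-map-1 xs)

-- Greedy choice: the first value takes `b ⊓ e`, and `e ∸ b` is left for the others.
∃-bounded-sum : ∀ b s e → e ≤ s * b →
                ∃[ f ] (∀ (i : Fin s) → f i ≤ b) × sum f ≡ e
∃-bounded-sum b zero    e e≤ = (λ ()) , (λ ()) , sym (n≤0⇒n≡0 e≤)
∃-bounded-sum b (suc s) e e≤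
  with f , f≤b , ∑f ← ∃-bounded-sum b s (e ∸ b) (m≤n+o⇒m∸n≤o e b e≤) =
    (λ { zero → b ⊓ e ; (suc i) → f i })
  , (λ { zero → m⊓n≤m b e ; (suc i) → f≤b i })
  , trans (cong (b ⊓ e +_) ∑f) (m⊓n+n∸m≡n b e)

-- Start from labels that are all 1 and distribute the surplus `t ∸ s`, at most `b` to each.
∃-labels : ∀ b s t → s ≤ t → t ≤ suc b * s →
           ∃[ ℓ ] (∀ (i : Fin s) → 1 ≤ ℓ i) × (∀ i → ℓ i ≤ suc b) × sum ℓ ≡ t
∃-labels b s t s≤t t≤
  with f , f≤b , ∑f ← ∃-bounded-sum b s (t ∸ s)
         (m≤n+o⇒m∸n≤o t s (subst (λ z → t ≤ s + z) (*-comm b s) t≤)) =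
    (λ i → 1 + f i)
  , (λ i → s≤s z≤n)
  , (λ i → s≤s (f≤b i))
  , trans (∑-distrib-+ (const 1) f)
          (trans (cong₂ _+_ (sum-one s) ∑f) (m+[n∸m]≡n s≤t))

-- Sums over non-neighbours

-- This is D. Since `adj G v v` is `false`, the label of `v` itself is counted.
nonNeighbourSum : ∀ {n} → Graph n → (Fin n → ℕ) → Fin n → ℕ
nonNeighbourSum {n} G ℓ v = ∑[ u < n ] (if adj G v u then 0 else ℓ u)

-- The order minus the degree, taken as an instance of D so that the facts about D in joins apply to
-- degrees as well.
codegree : ∀ {n} → Graph n → Fin n → ℕ
codegree G = nonNeighbourSum G (const 1)

module _ {n} (G : Graph n) where

  neighbourSum+nonNeighbourSum : ∀ ℓ v → neighbourSum G ℓ v + nonNeighbourSum G ℓ v ≡ sum ℓ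
  neighbourSum+nonNeighbourSum ℓ v = begin
    neighbourSum G ℓ v + nonNeighbourSum G ℓ v
      ≡⟨ cong (_+ nonNeighbourSum G ℓ v) (sum-filterᵇ-tabulate (adj G v) ℓ id) ⟩
    ∑[ u < n ] (if adj G v u then ℓ u else 0) + nonNeighbourSum G ℓ v
      ≡⟨ ∑-distrib-+ (λ u → if adj G v u then ℓ u else 0) _ ⟨
    ∑[ u < n ] ((if adj G v u then ℓ u else 0) + (if adj G v u then 0 else ℓ u))
      ≡⟨ sum-cong-≗ (λ u → split (adj G v u) (ℓ u)) ⟩
    sum ℓ ∎
    where
    open ≡-Reasoning
    split : ∀ b x → (if b then x else 0) + (if b then 0 else x) ≡ x
    split true  x = +-identityʳ x
    split false x = refl

  degree+codegree : ∀ v → degree G v + codegree G v ≡ n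
  degree+codegree v = trans
    (cong (_+ codegree G v) (length≡sum-map-1 (neighbours G v)))
    (trans (neighbourSum+nonNeighbourSum (const 1) v) (sum-one n))

  neighbourSum≡⇒nonNeighbourSum≡ : ∀ ℓ u v →
    neighbourSum G ℓ u ≡ neighbourSum G ℓ v → nonNeighbourSum G ℓ u ≡ nonNeighbourSum G ℓ v
  neighbourSum≡⇒nonNeighbourSum≡ ℓ u v eq =
    +-cancelˡ-≡ (neighbourSum G ℓ u) _ _
      (trans (neighbourSum+nonNeighbourSum ℓ u)
        (trans (sym (neighbourSum+nonNeighbourSum ℓ v))
               (cong (_+ nonNeighbourSum G ℓ v) (sym eq))))

  nonNeighbourSum≡⇒neighbourSum≡ : ∀ ℓ u v →
    nonNeighbourSum G ℓ u ≡ nonNeighbourSum G ℓ v → neighbourSum G ℓ u ≡ neighbourSum G ℓ v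
  nonNeighbourSum≡⇒neighbourSum≡ ℓ u v eq =
    +-cancelʳ-≡ (nonNeighbourSum G ℓ u) _ _
      (trans (neighbourSum+nonNeighbourSum ℓ u)
        (trans (sym (neighbourSum+nonNeighbourSum ℓ v))
               (cong (neighbourSum G ℓ v +_) (sym eq))))

  nonNeighbourSum≤ : ∀ a {ℓ} → (∀ v → ℓ v ≤ a) → ∀ v → nonNeighbourSum G ℓ v ≤ a * codegree G v
  nonNeighbourSum≤ a {ℓ} ℓ≤a v = ≤-trans (sum-mono-≤ bound)
    (≤-reflexive (sym (∑.*-distribˡ-sum a (λ u → if adj G v u then 0 else 1))))
    where
    bound : ∀ u → (if adj G v u then 0 else ℓ u) ≤ a * (if adj G v u then 0 else 1)
    bound u with adj G v u
    ... | true  = z≤n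
    ... | false = ≤-trans (ℓ≤a u) (≤-reflexive (sym (*-identityʳ a)))

  codegree≤order : ∀ v → codegree G v ≤ n
  codegree≤order v = m+n≤o⇒n≤o (degree G v) (≤-reflexive (degree+codegree v))

-- Joins

↑-elim : ∀ {m n} {P : Fin (m + n) → Set} →
         (∀ i → P (i ↑ˡ n)) → (∀ j → P (m ↑ʳ j)) → ∀ x → P x
↑-elim {m} {n} {P} l r x with splitAt m x | join-splitAt m n x
... | inj₁ i | eq = subst P eq (l i)
... | inj₂ j | eq = subst P eq (r j)

module _ {m n} (G : Graph m) (K : Graph n) where

  joinAdj : Fin m ⊎ Fin n → Fin m ⊎ Fin n → Bool
  joinAdj (inj₁ u) (inj₁ v) = adj G u v
  joinAdj (inj₂ u) (inj₂ v) = adj K u v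
  joinAdj _        _        = true

  joinAdj-sym : ∀ x y → joinAdj x y ≡ joinAdj y x
  joinAdj-sym (inj₁ u) (inj₁ v) = symmetric G u v
  joinAdj-sym (inj₁ u) (inj₂ v) = refl
  joinAdj-sym (inj₂ u) (inj₁ v) = refl
  joinAdj-sym (inj₂ u) (inj₂ v) = symmetric K u v

  joinAdj-irrefl : ∀ x → joinAdj x x ≡ false
  joinAdj-irrefl (inj₁ u) = loopless G u
  joinAdj-irrefl (inj₂ u) = loopless K u

infixr 5 _∨ᴳ_

_∨ᴳ_ : ∀ {m n} → Graph m → Graph n → Graph (m + n)
_∨ᴳ_ {m} G K = record
  { adj       = λ x y → joinAdj G K (splitAt m x) (splitAt m y)
  ; symmetric = λ x y → joinAdj-sym G K (splitAt m x) (splitAt m y)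
  ; loopless  = λ x → joinAdj-irrefl G K (splitAt m x)
  }

module _ {m n} (G : Graph m) (K : Graph n) where

  adj-∨ˡˡ : ∀ u v → adj (G ∨ᴳ K) (u ↑ˡ n) (v ↑ˡ n) ≡ adj G u v
  adj-∨ˡˡ u v rewrite splitAt-↑ˡ m u n | splitAt-↑ˡ m v n = refl

  adj-∨ˡʳ : ∀ u v → adj (G ∨ᴳ K) (u ↑ˡ n) (m ↑ʳ v) ≡ true
  adj-∨ˡʳ u v rewrite splitAt-↑ˡ m u n | splitAt-↑ʳ m n v = refl

  adj-∨ʳˡ : ∀ u v → adj (G ∨ᴳ K) (m ↑ʳ u) (v ↑ˡ n) ≡ true
  adj-∨ʳˡ u v rewrite splitAt-↑ʳ m n u | splitAt-↑ˡ m v n = refl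

  adj-∨ʳʳ : ∀ u v → adj (G ∨ᴳ K) (m ↑ʳ u) (m ↑ʳ v) ≡ adj K u v
  adj-∨ʳʳ u v rewrite splitAt-↑ʳ m n u | splitAt-↑ʳ m n v = refl

  ∨-induced : IsInducedSubgraph G (G ∨ᴳ K)
  ∨-induced = (_↑ˡ n) , (λ {x} {y} → ↑ˡ-injective n x y) , adj-∨ˡˡ

  nonNeighbourSum-∨ˡ : ∀ ℓ u →
    nonNeighbourSum (G ∨ᴳ K) ℓ (u ↑ˡ n) ≡ nonNeighbourSum G (ℓ ∘ (_↑ˡ n)) u
  nonNeighbourSum-∨ˡ ℓ u = begin
    nonNeighbourSum (G ∨ᴳ K) ℓ (u ↑ˡ n)
      ≡⟨ sum-↑ m _ ⟩
    ∑[ v < m ] (if adj (G ∨ᴳ K) (u ↑ˡ n) (v ↑ˡ n) then 0 else ℓ (v ↑ˡ n))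
      + ∑[ v < n ] (if adj (G ∨ᴳ K) (u ↑ˡ n) (m ↑ʳ v) then 0 else ℓ (m ↑ʳ v))
      ≡⟨ cong₂ _+_
           (sum-cong-≗ (λ v → cong (if_then 0 else ℓ (v ↑ˡ n)) (adj-∨ˡˡ u v)))
           (trans (sum-cong-≗ (λ v → cong (if_then 0 else ℓ (m ↑ʳ v)) (adj-∨ˡʳ u v)))
                  (∑.sum-replicate-zero n)) ⟩
    nonNeighbourSum G (ℓ ∘ (_↑ˡ n)) u + 0
      ≡⟨ +-identityʳ _ ⟩
    nonNeighbourSum G (ℓ ∘ (_↑ˡ n)) u ∎
    where open ≡-Reasoning

  nonNeighbourSum-∨ʳ : ∀ ℓ u →
    nonNeighbourSum (G ∨ᴳ K) ℓ (m ↑ʳ u) ≡ nonNeighbourSum K (ℓ ∘ (m ↑ʳ_)) u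
  nonNeighbourSum-∨ʳ ℓ u = trans (sum-↑ m _) (cong₂ _+_
    (trans (sum-cong-≗ (λ v → cong (if_then 0 else ℓ (v ↑ˡ n)) (adj-∨ʳˡ u v)))
           (∑.sum-replicate-zero m))
    (sum-cong-≗ (λ v → cong (if_then 0 else ℓ (m ↑ʳ v)) (adj-∨ʳʳ u v))))

  -- Equal neighbour sums in `G` give equal D in `G`, hence equal D in the join, hence equal
  -- neighbour sums there.
  ∨-restrict : ∀ {ℓ} → IsAdditiveLabelling (G ∨ᴳ K) ℓ → IsAdditiveLabelling G (ℓ ∘ (_↑ˡ n))
  ∨-restrict {ℓ} (positive , additive) =
      (λ v → positive (v ↑ˡ n))
    , λ u v uv S≡ → additive (u ↑ˡ n) (v ↑ˡ n) (trans (adj-∨ˡˡ u v) uv)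
        (nonNeighbourSum≡⇒neighbourSum≡ (G ∨ᴳ K) ℓ _ _
          (trans (nonNeighbourSum-∨ˡ ℓ u)
            (trans (neighbourSum≡⇒nonNeighbourSum≡ G _ u v S≡)
                   (sym (nonNeighbourSum-∨ˡ ℓ v)))))

  ∨-hasAdditiveLabelling : ∀ {k} → HasAdditiveLabelling (G ∨ᴳ K) k → HasAdditiveLabelling G k
  ∨-hasAdditiveLabelling (ℓ , additive , ℓ≤k) =
    ℓ ∘ (_↑ˡ n) , ∨-restrict additive , λ v → ℓ≤k (v ↑ˡ n)

  ∨-hasListAdditiveLabellings : ∀ {k} →
    HasListAdditiveLabellings (G ∨ᴳ K) k → HasListAdditiveLabellings G k
  ∨-hasListAdditiveLabellings {k} has L labelList =
    let ℓ , additive , ℓ∈ = has L⁺ labelList⁺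
    in ℓ ∘ (_↑ˡ n) , ∨-restrict additive
     , λ v → subst (ℓ (v ↑ˡ n) ∈_) (lookup-++ˡ L _ v) (ℓ∈ (v ↑ˡ n))
    where
    -- The labels chosen on `K` are discarded, so any `k` distinct positive integers can serve as
    -- lists there.
    [1⋯k] : List ℕ
    [1⋯k] = applyUpTo suc k
    [1⋯k]-labelList : IsLabelList k [1⋯k]
    [1⋯k]-labelList =
        Unique.applyUpTo⁺₁ suc k (λ i<j _ → <⇒≢ (s<s i<j))
      , length-applyUpTo suc k
      , All.applyUpTo⁺₂ suc k (λ _ → s≤s z≤n)
    L⁺ : Fin (m + n) → List ℕ
    L⁺ = L ++ const [1⋯k]
    labelList⁺ : ∀ x → IsLabelList k (L⁺ x)
    labelList⁺ = ↑-elim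
      (λ u → subst (IsLabelList k) (sym (lookup-++ˡ L _ u)) (labelList u))
      (λ u → subst (IsLabelList k) (sym (lookup-++ʳ L _ u)) [1⋯k]-labelList)

-- The invariant carried through repeated joins. The values of D lie in the half-open interval from
-- `s` to `t`, so that the factors of a join can occupy consecutive intervals.
record Balanced (a d s t : ℕ) {n} (G : Graph n) (ℓ : Fin n → ℕ) : Set where
  field
    positive   : ∀ v → 1 ≤ ℓ v
    bounded    : ∀ v → ℓ v ≤ a
    codegrees≤ : ∀ v → codegree G v ≤ d
    separating : ∀ u v → Edge G u v → nonNeighbourSum G ℓ u ≢ nonNeighbourSum G ℓ v
    above      : ∀ v → s ≤ nonNeighbourSum G ℓ v
    below      : ∀ v → nonNeighbourSum G ℓ v < t

  hasAdditiveLabelling : HasAdditiveLabelling G a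
  hasAdditiveLabelling =
    ℓ , (positive , λ u v uv → separating u v uv ∘ neighbourSum≡⇒nonNeighbourSum≡ G ℓ u v) , bounded

open Balanced

module _ {a d r s t m n} {G : Graph m} {K : Graph n} {ℓ : Fin m → ℕ} {κ : Fin n → ℕ}
         (r≤s : r ≤ s) (s≤t : s ≤ t) (g : Balanced a d r s G ℓ) (k : Balanced a d s t K κ) where

  private
    Dˡ : ∀ u → nonNeighbourSum (G ∨ᴳ K) (ℓ ++ κ) (u ↑ˡ n) ≡ nonNeighbourSum G ℓ u
    Dˡ u = trans (nonNeighbourSum-∨ˡ G K _ u)
      (sum-cong-≗ (λ v → cong (if adj G u v then 0 else_) (lookup-++ˡ ℓ κ v)))

    Dʳ : ∀ u → nonNeighbourSum (G ∨ᴳ K) (ℓ ++ κ) (m ↑ʳ u) ≡ nonNeighbourSum K κ u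
    Dʳ u = trans (nonNeighbourSum-∨ʳ G K _ u)
      (sum-cong-≗ (λ v → cong (if adj K u v then 0 else_) (lookup-++ʳ ℓ κ v)))

    D< : ∀ u v → nonNeighbourSum (G ∨ᴳ K) (ℓ ++ κ) (u ↑ˡ n)
               < nonNeighbourSum (G ∨ᴳ K) (ℓ ++ κ) (m ↑ʳ v)
    D< u v rewrite Dˡ u | Dʳ v = <-≤-trans (below g u) (above k v)

  -- Codegrees and values of D inside the factors are unchanged, so only the edges between the
  -- factors are new. `D<` settles these: D is below `s` on one side and at least `s` on the other.
  ∨-balanced : Balanced a d r t (G ∨ᴳ K) (ℓ ++ κ)
  ∨-balanced .positive = ↑-elim
    (λ u → ≤-trans (positive g u) (≤-reflexive (sym (lookup-++ˡ ℓ κ u))))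
    (λ u → ≤-trans (positive k u) (≤-reflexive (sym (lookup-++ʳ ℓ κ u))))
  ∨-balanced .bounded = ↑-elim
    (λ u → ≤-trans (≤-reflexive (lookup-++ˡ ℓ κ u)) (bounded g u))
    (λ u → ≤-trans (≤-reflexive (lookup-++ʳ ℓ κ u)) (bounded k u))
  ∨-balanced .codegrees≤ = ↑-elim
    (λ u → ≤-trans (≤-reflexive (nonNeighbourSum-∨ˡ G K _ u)) (codegrees≤ g u))
    (λ u → ≤-trans (≤-reflexive (nonNeighbourSum-∨ʳ G K _ u)) (codegrees≤ k u))
  ∨-balanced .separating = ↑-elim
    (λ u → ↑-elim
      (λ v uv eq → separating g u v (trans (sym (adj-∨ˡˡ G K u v)) uv)
                     (trans (sym (Dˡ u)) (trans eq (Dˡ v))))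
      (λ v _ → <⇒≢ (D< u v)))
    (λ u → ↑-elim
      (λ v _ → >⇒≢ (D< v u))
      (λ v uv eq → separating k u v (trans (sym (adj-∨ʳʳ G K u v)) uv)
                     (trans (sym (Dʳ u)) (trans eq (Dʳ v)))))
  ∨-balanced .above = ↑-elim
    (λ u → ≤-trans (above g u) (≤-reflexive (sym (Dˡ u))))
    (λ u → ≤-trans r≤s (≤-trans (above k u) (≤-reflexive (sym (Dʳ u)))))
  ∨-balanced .below = ↑-elim
    (λ u → ≤-trans (s≤s (≤-reflexive (Dˡ u))) (≤-trans (below g u) s≤t))
    (λ u → ≤-trans (s≤s (≤-reflexive (Dʳ u))) (below k u))

-- Complete multipartite graphs

edgeless : ∀ n → Graph n
edgeless n = record { adj = λ _ _ → false ; symmetric = λ _ _ → refl ; loopless = λ _ → refl }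

-- Without edges all vertices are non-neighbours of each vertex, so D is constantly the label sum
-- and the codegree is constantly `s`.
edgeless-balanced : ∀ b {d s t} → s ≤ d → s ≤ t → t ≤ suc b * s →
                    ∃[ ℓ ] Balanced (suc b) d t (suc t) (edgeless s) ℓ
edgeless-balanced b {d} {s} {t} s≤d s≤t t≤as
  with ℓ , 1≤ℓ , ℓ≤a , ∑ℓ ← ∃-labels b s t s≤t t≤as = ℓ , record
  { positive   = 1≤ℓ
  ; bounded    = ℓ≤a
  ; codegrees≤ = λ _ → ≤-trans (≤-reflexive (sum-one s)) s≤d
  ; separating = λ _ _ ()
  ; above      = λ _ → ≤-reflexive (sym ∑ℓ)
  ; below      = λ _ → s≤s (≤-reflexive ∑ℓ)
  }

-- Hides the graph and its labels, so that the recursive constructions track only the parameters and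
-- the order.
record BalancedGraph (a d s t n : ℕ) : Set where
  constructor balancedGraph
  field
    {graph}  : Graph n
    {labels} : Fin n → ℕ
    balanced : Balanced a d s t graph labels

open BalancedGraph

-- The new part takes the first free value `t` of D.
addPart : ∀ b {d r t n} s → r ≤ t → s ≤ d → s ≤ t → t ≤ suc b * s →
          BalancedGraph (suc b) d r t n → BalancedGraph (suc b) d r (suc t) (n + s)
addPart b s r≤t s≤d s≤t t≤as B =
  balancedGraph (∨-balanced r≤t (n≤1+n _) (balanced B) (proj₂ (edgeless-balanced b s≤d s≤t t≤as)))

-- One part for each label sum from `g + 1` to `g + j`, of size equal to that sum, so that all its
-- labels are 1. The order is a difference of two triangular numbers, here doubled and rearranged to
-- avoid division and subtraction.
smallParts : ∀ b {d} g j → g + j ≤ d →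
  ∃[ n ] 2 * n + g * suc g ≡ (g + j) * suc (g + j) × BalancedGraph (suc b) d (suc g) (suc (g + j)) n
smallParts b g zero    _ = 0 , cong (λ x → x * suc x) (sym (+-identityʳ g))
  , balancedGraph {graph = edgeless 0} {labels = λ ()} (record
      { positive = λ () ; bounded = λ () ; codegrees≤ = λ ()
      ; separating = λ () ; above = λ () ; below = λ () })
smallParts b {d} g (suc j) g+1+j≤d
  with n , eq , B ← smallParts b g j (≤-trans (+-monoʳ-≤ g (n≤1+n j)) g+1+j≤d) =
    n + suc (g + j)
  , trans (rearrange n (g + j) (g * suc g))
      (trans (cong (_+ 2 * suc (g + j)) eq)
        (trans (square (g + j)) (cong (λ x → x * suc x) (sym (+-suc g j)))))
  , subst (λ x → BalancedGraph (suc b) d (suc g) (suc x) (n + suc (g + j))) (sym (+-suc g j))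
      (addPart b (suc (g + j)) (s≤s (m≤m+n g j))
        (subst (_≤ d) (+-suc g j) g+1+j≤d) ≤-refl (m≤m+n (suc (g + j)) _) B)
  where
  rearrange : ∀ n x e → 2 * (n + suc x) + e ≡ (2 * n + e) + 2 * suc x
  rearrange = solve-∀
  square : ∀ x → x * suc x + 2 * suc x ≡ suc x * suc (suc x)
  square = solve-∀

-- Adds parts of size `d` with label sums from `d` to `d + j - 1`. The bound on `j` keeps these sums
-- within reach of `d` labels that are at most `suc b`.
largeParts : ∀ b {d r n} → r ≤ d → BalancedGraph (suc b) d r d n → ∀ j → j ≤ b * d →
  BalancedGraph (suc b) d r (j + d) (j * d + n)
largeParts b r≤d B zero    _ = B
largeParts b {d} {r} {n} r≤d B (suc j) j<bd =
  subst (BalancedGraph (suc b) d r (suc (j + d)))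
    (trans (+-comm (j * d + n) d) (sym (+-assoc d (j * d) n)))
    (addPart b d (≤-trans r≤d (m≤n+m d j)) ≤-refl (m≤n+m d j)
      (subst (_≤ suc b * d) (+-comm d j) (+-monoʳ-≤ d (<⇒≤ j<bd)))
      (largeParts b r≤d B j (<⇒≤ j<bd)))

-- Bounding the order by counting the fibres of D

#[_≡_] : ∀ {n} → (Fin n → ℕ) → ℕ → ℕ
#[_≡_] {n} f t = ∑[ v < n ] (if f v ≡ᵇ t then 1 else 0)

#[_<_] : ∀ {n} → (Fin n → ℕ) → ℕ → ℕ
#[_<_] {n} f t = ∑[ v < n ] (if f v <ᵇ t then 1 else 0)

#<suc : ∀ {n} (f : Fin n → ℕ) t → #[ f < suc t ] ≡ #[ f < t ] + #[ f ≡ t ]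
#<suc f t = trans (sum-cong-≗ (λ v → indicator (f v) t))
                  (∑-distrib-+ (λ v → if f v <ᵇ t then 1 else 0) _)
  where
  indicator : ∀ x t → (if x <ᵇ suc t then 1 else 0)
                    ≡ (if x <ᵇ t then 1 else 0) + (if x ≡ᵇ t then 1 else 0)
  indicator zero    zero    = refl
  indicator zero    (suc t) = refl
  indicator (suc x) zero    = refl
  indicator (suc x) (suc t) = indicator x t

#<-all : ∀ {n} (f : Fin n → ℕ) {t} → (∀ v → f v < t) → #[ f < t ] ≡ n
#<-all {n} f f<t = trans
  (sum-cong-≗ (λ v → cong (if_then 1 else 0) (T⇒≡true (<⇒<ᵇ (f<t v))))) (sum-one n)
  where
  T⇒≡true : ∀ {x} → T x → x ≡ true
  T⇒≡true {true} _ = refl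

-- An empty fibre counts 0, so the bound may be proved with a vertex of the fibre at hand.
#≡-bound : ∀ {n} (f : Fin n → ℕ) {t B} → (∀ v → f v ≡ t → #[ f ≡ t ] ≤ B) → #[ f ≡ t ] ≤ B
#≡-bound {n} f {t} bound with any? (λ v → f v ≟ t)
... | yes (v , fv≡t) = bound v fv≡t
... | no  empty      = ≤-trans (≤-reflexive (trans
  (sum-cong-≗ (λ v → cong (if_then 1 else 0) (dec-false (f v ≟ t) (λ eq → empty (v , eq)))))
  (∑.sum-replicate-zero n))) z≤n

module _ {n} (f : Fin n → ℕ) where

  -- Adding up the fibre bounds 0, 1, ..., `t - 1` gives t(t - 1)/2; the doubled form with `t` moved
  -- to the left avoids division and subtraction.
  #<-small : (∀ t → #[ f ≡ t ] ≤ t) → ∀ t → 2 * #[ f < t ] + t ≤ t * t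
  #<-small fibre zero    = ≤-reflexive (cong (λ x → 2 * x + 0) (∑.sum-replicate-zero n))
  #<-small fibre (suc t) = begin
    2 * #[ f < suc t ] + suc t              ≡⟨ cong (λ x → 2 * x + suc t) (#<suc f t) ⟩
    2 * (#[ f < t ] + #[ f ≡ t ]) + suc t   ≤⟨ +-monoˡ-≤ (suc t) (*-monoʳ-≤ 2 (+-monoʳ-≤ #[ f < t ] (fibre t))) ⟩
    2 * (#[ f < t ] + t) + suc t            ≡⟨ regroup #[ f < t ] t ⟩
    (2 * #[ f < t ] + t) + (2 * t + 1)      ≤⟨ +-monoˡ-≤ (2 * t + 1) (#<-small fibre t) ⟩
    t * t + (2 * t + 1)                     ≡⟨ square t ⟩
    suc t * suc t                           ∎
    where
    open ≤-Reasoning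
    regroup : ∀ x t → 2 * (x + t) + suc t ≡ (2 * x + t) + (2 * t + 1)
    regroup = solve-∀
    square : ∀ t → t * t + (2 * t + 1) ≡ suc t * suc t
    square = solve-∀

  #<-large : ∀ {d} → (∀ t → #[ f ≡ t ] ≤ d) → ∀ t j → #[ f < j + t ] ≤ j * d + #[ f < t ]
  #<-large     fibre t zero    = ≤-refl
  #<-large {d} fibre t (suc j) = begin
    #[ f < suc (j + t) ]              ≡⟨ #<suc f (j + t) ⟩
    #[ f < j + t ] + #[ f ≡ j + t ]   ≤⟨ +-mono-≤ (#<-large fibre t j) (fibre (j + t)) ⟩
    (j * d + #[ f < t ]) + d          ≡⟨ regroup (j * d) #[ f < t ] d ⟩
    (d + j * d) + #[ f < t ]          ∎
    where
    open ≤-Reasoning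
    regroup : ∀ x y d → (x + y) + d ≡ (d + x) + y
    regroup = solve-∀

module _ {n} (G : Graph n) {ℓ : Fin n → ℕ} (additive : IsAdditiveLabelling G ℓ) where

  private
    D : Fin n → ℕ
    D = nonNeighbourSum G ℓ

  -- Vertices with the same D as `v` are non-neighbours of `v`, and each has weight at least 1.
  -- Taking `κ` to be `ℓ` bounds the fibre by the value `D v` itself; taking it constantly 1 bounds
  -- the fibre by the codegree.
  fibre≤ : ∀ {κ : Fin n → ℕ} → (∀ v → 1 ≤ κ v) →
           ∀ v → #[ D ≡ D v ] ≤ nonNeighbourSum G κ v
  fibre≤ {κ} 1≤κ v = sum-mono-≤ pointwise
    where
    pointwise : ∀ u → (if D u ≡ᵇ D v then 1 else 0) ≤ (if adj G v u then 0 else κ u)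
    pointwise u with adj G v u in vu
    ... | true
      rewrite dec-false (D u ≟ D v) (λ eq → proj₂ additive v u vu
                (nonNeighbourSum≡⇒neighbourSum≡ G ℓ v u (sym eq))) = z≤n
    ... | false with D u ≡ᵇ D v
    ...   | true  = 1≤κ u
    ...   | false = z≤n

  order-bound : ∀ b d → (∀ v → ℓ v ≤ suc b) → (∀ v → codegree G v ≤ d) →
                2 * n ≤ suc (2 * b) * (d * d) + d
  -- Values of D up to `d` are counted by `#<-small`, the `b * d` values above by `#<-large`. The
  -- summand `suc d` on both sides matches the form of `#<-small`.
  order-bound b d ℓ≤a codegree≤d = +-cancelʳ-≤ (suc d) _ _ (begin
    2 * n + suc d                                   ≡⟨ cong (λ x → 2 * x + suc d) (#<-all D D<) ⟨
    2 * #[ D < b * d + suc d ] + suc d              ≤⟨ +-monoˡ-≤ (suc d) (*-monoʳ-≤ 2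
                                                         (#<-large D fibre≤d (suc d) (b * d))) ⟩
    2 * (b * d * d + #[ D < suc d ]) + suc d        ≡⟨ regroup (b * d * d) #[ D < suc d ] d ⟩
    2 * (b * d * d) + (2 * #[ D < suc d ] + suc d)  ≤⟨ +-monoʳ-≤ (2 * (b * d * d))
                                                         (#<-small D fibre≤t (suc d)) ⟩
    2 * (b * d * d) + suc d * suc d                 ≡⟨ expand b d ⟩
    (suc (2 * b) * (d * d) + d) + suc d             ∎)
    where
    open ≤-Reasoning
    D< : ∀ v → D v < b * d + suc d
    D< v = begin-strict
      D v                      ≤⟨ nonNeighbourSum≤ G (suc b) ℓ≤a v ⟩
      suc b * codegree G v     ≤⟨ *-monoʳ-≤ (suc b) (codegree≤d v) ⟩
      d + b * d                ≡⟨ +-comm d (b * d) ⟩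
      b * d + d                <⟨ +-monoʳ-< (b * d) ≤-refl ⟩
      b * d + suc d            ∎
    fibre≤t : ∀ t → #[ D ≡ t ] ≤ t
    fibre≤t t = #≡-bound D λ { v refl → fibre≤ (proj₁ additive) v }
    fibre≤d : ∀ t → #[ D ≡ t ] ≤ d
    fibre≤d t = #≡-bound D λ { v refl → ≤-trans (fibre≤ (λ _ → ≤-refl) v) (codegree≤d v) }
    regroup : ∀ x y d → 2 * (x + y) + suc d ≡ 2 * x + (2 * y + suc d)
    regroup = solve-∀
    expand : ∀ b d → 2 * (b * d * d) + suc d * suc d ≡ (suc (2 * b) * (d * d) + d) + suc d
    expand = solve-∀

-- From quadratic bounds on the order to square-root estimates

2a∸1 : ∀ b → 2 * suc b ∸ 1 ≡ suc (2 * b)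
2a∸1 b = +-suc b (b + 0)

upperEstimate-mono : ∀ {a C C′ n δ} → C ≤ C′ → UpperEstimate a C n δ → UpperEstimate a C′ n δ
upperEstimate-mono {a} {n = n} {δ} C≤C′ est =
  ≤-trans est (*-monoʳ-≤ (2 * a ∸ 1) (^-monoˡ-≤ 2 (+-monoʳ-≤ (n ∸ δ) C≤C′)))

-- Passing from d² to (d + 1)² absorbs the linear term of `order-bound`, since d ≤ (2a - 1)(2d + 1);
-- this is why the constant 1 suffices.
upperEstimate : ∀ {a n} (G : Graph n) {δ} →
  1 ≤ a → HasAdditiveLabelling G a → IsMinDegree G δ → UpperEstimate a 1 n δ
upperEstimate {suc b} {n} G {δ} (s≤s _) (ℓ , additive , ℓ≤a) (_ , δ≤) = begin
  2 * n                              ≤⟨ order-bound G additive b d ℓ≤a codegree≤d ⟩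
  suc (2 * b) * (d * d) + d          ≤⟨ m≤m+n _ _ ⟩
  (suc (2 * b) * (d * d) + d) + (suc d + 2 * b * (2 * d + 1))
                                     ≡⟨ square b d ⟩
  suc (2 * b) * (d + 1) ^ 2          ≡⟨ cong (_* (d + 1) ^ 2) (2a∸1 b) ⟨
  (2 * suc b ∸ 1) * (d + 1) ^ 2      ∎
  where
  open ≤-Reasoning
  d = n ∸ δ
  codegree≤d : ∀ v → codegree G v ≤ d
  codegree≤d v = subst (_≤ d)
    (trans (cong (_∸ degree G v) (sym (degree+codegree G v))) (m+n∸m≡n (degree G v) _))
    (∸-monoʳ-≤ n (δ≤ v))
  square : ∀ b d → (suc (2 * b) * (d * d) + d) + (suc d + 2 * b * (2 * d + 1))
                 ≡ suc (2 * b) * ((d + 1) * ((d + 1) * 1))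
  square = solve-∀

-- For d ≥ e + 1 the linear term `d` outweighs `e`, and the square of `d` is already small enough;
-- for d ≤ e + 1 the truncated difference is 0.
[d∸C]²-bound : ∀ b d e x → 2 * x + e ≡ suc (2 * b) * (d * d) + d →
               suc (2 * b) * (d ∸ suc e) ^ 2 ≤ 2 * x
[d∸C]²-bound b d e x eq with ≤-total d (suc e)
... | inj₁ d≤C rewrite m≤n⇒m∸n≡0 d≤C | *-zeroʳ (2 * b) = z≤n
... | inj₂ C≤d with y , refl ← m≤n⇒∃[o]m+o≡n C≤d = +-cancelʳ-≤ e _ _ (begin
  suc (2 * b) * (suc e + y ∸ suc e) ^ 2 + e        ≡⟨ cong (λ z → suc (2 * b) * z ^ 2 + e) (m+n∸m≡n (suc e) y) ⟩
  suc (2 * b) * y ^ 2 + e                          ≤⟨ m≤m+n _ _ ⟩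
  (suc (2 * b) * y ^ 2 + e) + (suc (2 * b) * (suc e * suc e + 2 * suc e * y) + (1 + y))
                                                   ≡⟨ expand b e y ⟩
  suc (2 * b) * ((suc e + y) * (suc e + y)) + (suc e + y) ≡⟨ eq ⟨
  2 * x + e                                        ∎)
  where
  open ≤-Reasoning
  expand : ∀ b e y →
    (suc (2 * b) * (y * (y * 1)) + e) + (suc (2 * b) * (suc e * suc e + 2 * suc e * y) + (1 + y))
      ≡ suc (2 * b) * ((suc e + y) * (suc e + y)) + (suc e + y)
  expand = solve-∀

-- Construction of the extension

balancedOfLabelling : ∀ {h a d} (H : Graph h) → h ≤ d →
  ((ℓ , _) : HasAdditiveLabelling H a) → Balanced a d 0 (suc (a * h)) H ℓ
balancedOfLabelling {a = a} H h≤d (ℓ , (1≤ℓ , additive) , ℓ≤a) = record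
  { positive   = 1≤ℓ
  ; bounded    = ℓ≤a
  ; codegrees≤ = λ v → ≤-trans (codegree≤order H v) h≤d
  ; separating = λ u v uv → additive u v uv ∘ nonNeighbourSum≡⇒neighbourSum≡ H ℓ u v
  ; above      = λ _ → z≤n
  ; below      = λ v → s≤s (≤-trans (nonNeighbourSum≤ H a ℓ≤a v) (*-monoʳ-≤ a (codegree≤order H v)))
  }

minDegree : ∀ {n d} (G : Graph n) v → codegree G v ≡ d → (∀ u → codegree G u ≤ d) →
            IsMinDegree G (n ∸ d)
minDegree {n} {d} G v refl codegree≤d =
    (v , sym (trans (cong (_∸ d) (sym (degree+codegree G v))) (m+n∸n≡m (degree G v) d)))
  , λ u → m≤n+o⇒m∸n≤o n d (begin
      n                           ≡⟨ degree+codegree G u ⟨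
      degree G u + codegree G u   ≤⟨ +-monoʳ-≤ (degree G u) (codegree≤d u) ⟩
      degree G u + d              ≡⟨ +-comm (degree G u) d ⟩
      d + degree G u              ∎)
  where open ≤-Reasoning

module _ (b : ℕ) {h} (H : Graph h) (η : IsAdditiveNumber H (suc b)) (N : ℕ) where

  private
    -- e is twice the number of vertices that leaving out the parts with t ≤ g costs.
    g e d : ℕ
    g = suc b * h
    e = g * suc g
    -- At least `h`, to cover the codegrees in `H`; at least `N`, to make the order large; and
    -- greater than `g`, so that the parts with label sums below `d` can start at `g + 1`.
    d = suc (g + (h + N))

    h≤d : h ≤ d
    h≤d = ≤-trans (m≤m+n h N) (≤-trans (m≤n+m (h + N) g) (n≤1+n _))

    N≤d : N ≤ d
    N≤d = ≤-trans (m≤n+m N h) (≤-trans (m≤n+m (h + N) g) (n≤1+n _))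

    1+g≤d : suc g ≤ d
    1+g≤d = s≤s (m≤m+n g (h + N))

    1+g≤bd+d : suc g ≤ b * d + d
    1+g≤bd+d = ≤-trans 1+g≤d (m≤n+m d (b * d))

  extension :
    ∃[ n ] Σ[ G ∈ Graph n ] ∃[ δ ]
      N ≤ n
      × IsInducedSubgraph H G
      × IsAdditiveNumber G (suc b)
      × (∀ k m → IsListAdditiveNumber G k → IsListAdditiveNumber H m → m ≤ k)
      × IsMinDegree G δ
      × LowerEstimate (suc b) (suc e) n δ
      × UpperEstimate (suc b) (suc e) n δ
  extension
    -- Since `d` is `suc (g + (h + N))`, the small parts have label sums from `g + 1` to `d - 1`,
    -- and the large ones continue from `d`.
    with s , 2s+e≡ , S ← smallParts b {d} g (h + N) (n≤1+n _)
    with M ← largeParts b 1+g≤d S (b * d) ≤-refl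
    -- The last part, with label sum a d, is kept apart to give an explicit vertex of codegree
    -- exactly `d`.
    with κ , K-balanced ← edgeless-balanced b {d} {d} {b * d + d} ≤-refl (m≤n+m d (b * d))
                            (≤-reflexive (+-comm (b * d) d)) =
      n , G , n ∸ d
    , ≤-trans N≤d d≤n
    , ∨-induced H K
    , (s≤s z≤n , hasG , λ j 1≤j has → proj₂ (proj₂ η) j 1≤j (∨-hasAdditiveLabelling H K has))
    , (λ k m (1≤k , has , _) (_ , _ , least) → least k 1≤k (∨-hasListAdditiveLabellings H K has))
    , min
    -- The bound is shown for the `m` vertices outside `H`; the other `h` vertices only enlarge the
    -- right-hand side.
    , subst₂ _≤_
        (cong₂ (λ x y → x * (y ∸ suc e) ^ 2) (sym (2a∸1 b)) (sym (m∸[m∸n]≡n d≤n)))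
        refl
        (≤-trans ([d∸C]²-bound b d e m 2m+e≡) (*-monoʳ-≤ 2 (m≤n+m m h)))
    , upperEstimate-mono {suc b} {n = n} {n ∸ d} (s≤s z≤n) (upperEstimate G (s≤s z≤n) hasG min)
    where
    m n : ℕ
    m = (b * d * d + s) + d
    n = h + m
    K : Graph m
    K = graph M ∨ᴳ edgeless d
    G : Graph n
    G = H ∨ᴳ K
    G-balanced : Balanced (suc b) d 0 (suc (b * d + d)) G _
    -- The values of D lie between 0 and `g` on `H`, between `g + 1` and a d - 1 on the parts of
    -- `M`, and equal a d on the last part.
    G-balanced = ∨-balanced z≤n (≤-trans 1+g≤bd+d (n≤1+n _))
      (balancedOfLabelling H h≤d (proj₁ (proj₂ η)))
      (∨-balanced 1+g≤bd+d (n≤1+n _) (balanced M) K-balanced)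
    hasG : HasAdditiveLabelling G (suc b)
    hasG = hasAdditiveLabelling G-balanced
    d≤n : d ≤ n
    d≤n = ≤-trans (m≤n+m d (b * d * d + s)) (m≤n+m m h)
    min : IsMinDegree G (n ∸ d)
    -- The non-neighbours of a vertex of the last part are the `d` vertices of that part, itself
    -- included.
    min = minDegree G (h ↑ʳ ((b * d * d + s) ↑ʳ zero))
      (trans (nonNeighbourSum-∨ʳ H K _ _)
        (trans (nonNeighbourSum-∨ʳ (graph M) (edgeless d) _ zero) (sum-one d)))
      (codegrees≤ G-balanced)
    2m+e≡ : 2 * m + e ≡ suc (2 * b) * (d * d) + d
    2m+e≡ = trans (regroup (b * d * d) s d e)
      (trans (cong (_+ (2 * (b * d * d) + 2 * d)) 2s+e≡) (expand b (g + (h + N))))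
      where
      regroup : ∀ x s d e → 2 * ((x + s) + d) + e ≡ (2 * s + e) + (2 * x + 2 * d)
      regroup = solve-∀
      expand : ∀ b x → x * suc x + (2 * (b * suc x * suc x) + 2 * suc x)
                     ≡ suc (2 * b) * (suc x * suc x) + suc x
      expand = solve-∀

theorem3 : ∀ (a : ℕ) →
    (∀ (h : ℕ) (H : Graph h) → IsAdditiveNumber H a →
    ∃[ C ] ∀ (N : ℕ) →
    ∃[ n ] Σ[ G ∈ Graph n ] ∃[ δ ]
    N ≤ n
    × IsInducedSubgraph H G
    × IsAdditiveNumber G a
    × (∀ k m → IsListAdditiveNumber G k → IsListAdditiveNumber H m → m ≤ k)
    × IsMinDegree G δ
    × LowerEstimate a C n δ
    × UpperEstimate a C n δ)
    × (∃[ C ] ∀ (n : ℕ) (G : Graph n) (δ : ℕ) →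
    IsAdditiveNumber G a → IsMinDegree G δ → UpperEstimate a C n δ)
-- Additive numbers are positive by definition, so both claims are vacuous and 0 is a default value.
theorem3 zero = (λ { _ _ (() , _) }) , 0 , λ { _ _ _ (() , _) }
theorem3 (suc b) =
    -- The inferred constant is `suc (g * suc g)` with g = a h, which does not depend on `N`.
    (λ h H η → _ , extension b H η)
  , 1 , λ n G δ (1≤a , has , _) → upperEstimate G 1≤a has
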